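{- Any $G_{\delta\sigma}$ ideal $\mathcal J$ on $\omega$ is extendable to an $F_\sigma$ ideal, i.e. there is an $F_\sigma$ ideal $\mathcal J'$ on $\omega$ with $\mathcal J\subseteq\mathcal J'$.
   Context: An ideal on $\omega$ is a family of subsets of $\omega$ closed under finite unions and subsets, containing all finite sets and not containing $\omega$. $F_\sigma$ and $G_{\delta\sigma}$ (countable unions of $G_\delta$ sets) refer to subsets of $\mathcal P(\omega)$ with the Cantor space topology, identifying sets with characteristic functions in $\{0,1\}^\omega$. -}

module Defs where

open import Data.Bool.Base using (Bool; true; _∨_)
open import Data.List.Base using (List)
import Data.List.Membership.Propositional as List
open import Data.Nat.Base using (ℕ; _<_)
open import Data.Product.Base using (Σ-syntax; ∃-syntax; _×_)
open import Level using (Level; suc)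
open import Relation.Binary.PropositionalEquality.Core using (_≡_)
open import Relation.Unary using (Pred; _∈_; _∉_; _≐_; ∁; ⋃; ⋂)

private
  variable
    ℓ : Level

-- Subsets of ω are identified with their characteristic functions, so that
-- 𝒫ω is also the Cantor space {0,1}^ω.
𝒫ω : Set
𝒫ω = ℕ → Bool

infix 4 _∈ω_ _⊆ω_
infixr 6 _∪ω_

_∈ω_ : ℕ → 𝒫ω → Set
n ∈ω x = x n ≡ true

_⊆ω_ : 𝒫ω → 𝒫ω → Set
x ⊆ω y = ∀ n → n ∈ω x → n ∈ω y

_∪ω_ : 𝒫ω → 𝒫ω → 𝒫ω
(x ∪ω y) n = x n ∨ y n

ω : 𝒫ω
ω _ = true

Finite : 𝒫ω → Set
Finite x = ∃[ ns ] (∀ n → n ∈ω x → n List.∈ ns)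

-- Binary unions suffice: the empty union is covered by `finite`.
record IsIdeal (J : Pred 𝒫ω ℓ) : Set ℓ where
  field
    ⊆-closed : ∀ {x y} → x ⊆ω y → y ∈ J → x ∈ J
    ∪-closed : ∀ {x y} → x ∈ J → y ∈ J → x ∪ω y ∈ J
    finite   : ∀ {x} → Finite x → x ∈ J
    proper   : ω ∉ J

-- The basic open neighbourhoods of x in the product topology are the sets
-- { y | x ≈[ n ] y }.
_≈[_]_ : 𝒫ω → ℕ → 𝒫ω → Set
x ≈[ n ] y = ∀ i → i < n → x i ≡ y i

IsOpen : Pred 𝒫ω ℓ → Set ℓ
IsOpen U = ∀ x → x ∈ U → ∃[ n ] (∀ y → x ≈[ n ] y → y ∈ U)

IsClosed : Pred 𝒫ω ℓ → Set ℓ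
IsClosed C = IsOpen (∁ C)

IsFσ : Pred 𝒫ω ℓ → Set (suc ℓ)
IsFσ {ℓ} A =
  Σ[ C ∈ (ℕ → Pred 𝒫ω ℓ) ] (∀ n → IsClosed (C n)) × A ≐ ⋃ ℕ C

IsGδ : Pred 𝒫ω ℓ → Set (suc ℓ)
IsGδ {ℓ} A =
  Σ[ U ∈ (ℕ → Pred 𝒫ω ℓ) ] (∀ n → IsOpen (U n)) × A ≐ ⋂ ℕ U

IsGδσ : Pred 𝒫ω ℓ → Set (suc ℓ)
IsGδσ {ℓ} A =
  Σ[ G ∈ (ℕ → Pred 𝒫ω ℓ) ] (∀ n → IsGδ (G n)) × A ≐ ⋃ ℕ G

{-# OPTIONS --safe #-}
module Submission where

-- For a proper ideal L ⊇ J and a Gδ set A ⊆ J, every nonempty D ⊆ A has a nonempty relatively open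
-- part whose closure still generates a proper ideal together with L.  Otherwise every neighbourhood
-- in D has finitely many limit points covering ω modulo L, so each L-positive set X has an
-- L-positive trace X ∩ x on one of them.  Iterating, one fuses finite pieces of a decreasing sequence of
-- such traces into a set u lying below a limit point y ∈ A, so that u ∈ J; but each piece can be chosen so
-- as to escape one more of the Gδ sets composing J, because by a Baire category argument none of
-- these is dense below a J-positive set.
--
-- Hence J ⊆ J′ for any Fσ ideal J′ compatible with J (no member of J covers ω together with a member of J′) that
-- is saturated: it contains each trace of a Gδ piece of J on a basic open set that some larger
-- compatible Fσ ideal contains.  A saturated J′ is the union of a chain that treats the countably many
-- traces one by one.

open import Defs
open import Axiom.ExcludedMiddle using (ExcludedMiddle)
open import Axiom.DoubleNegationElimination using (em⇒dne)
open import Data.Bool.Base using (true; false; _∧_)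
open import Data.Bool.Properties using (∨-zeroʳ; ∧-conicalˡ; ∧-conicalʳ; ¬-not)
open import Data.List.Base using ([]; upTo)
open import Data.List.Extrema.Nat using (max; xs≤max)
open import Data.List.Membership.Propositional.Properties using (∈-upTo⁺)
import Data.List.Relation.Unary.All as All
open import Data.Nat.Base using (ℕ; zero; suc; _≤_; _<_; _⊔_; z≤n; s≤s; _≤′_; ≤′-refl; ≤′-step)
open import Data.Nat.Binary.Base using (ℕᵇ; zero; 2[1+_]; 1+[2_]; fromℕ; toℕ)
open import Data.Nat.Binary.Properties using (fromℕ-toℕ; toℕ-fromℕ)
open import Data.Nat.Properties
  using (≤-refl; ≤-trans; <-≤-trans; <⇒≤; <-≤-connex; ≤-total; n<1+n; n≤1+n;
         m<1+n⇒m<n∨m≡n; m≤m⊔n; m≤n⊔m; <⇒≱; ≤⇒≤′)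
open import Data.Product.Base using (Σ-syntax; ∃-syntax; _×_; _,_; proj₁; proj₂; map₁)
open import Data.Sum.Base using (_⊎_; inj₁; inj₂; [_,_]′)
open import Function.Base using (_∘_)
open import Level using (Level; Lift; lift)
open import Relation.Binary.PropositionalEquality.Core using (_≡_; refl; sym; trans; cong; subst)
open import Relation.Nullary.Decidable.Core using (yes; no)
open import Relation.Nullary.Negation.Core using (¬_; contradiction)
open import Relation.Unary using (Pred; _∈_; _∉_; _⊆_; _∩_; ⋃)

private
  variable
    ℓ : Level
    x y z s : 𝒫ω
    m n : ℕ
    A B C J K L : Pred 𝒫ω ℓ

-- Boolean algebra of subsets of ω.

infixr 7 _∩ω_

_∩ω_ : 𝒫ω → 𝒫ω → 𝒫ω
(x ∩ω y) n = x n ∧ y n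

∅ω : 𝒫ω
∅ω _ = false

⊆ω-refl : x ⊆ω x
⊆ω-refl _ i∈x = i∈x

⊆ω-trans : x ⊆ω y → y ⊆ω z → x ⊆ω z
⊆ω-trans x⊆y y⊆z i = y⊆z i ∘ x⊆y i

∈∪⁺ˡ : ∀ (x y : 𝒫ω) → x ⊆ω x ∪ω y
∈∪⁺ˡ x y i i∈x rewrite i∈x = refl

∈∪⁺ʳ : ∀ (x y : 𝒫ω) → y ⊆ω x ∪ω y
∈∪⁺ʳ x y i i∈y rewrite i∈y = ∨-zeroʳ (x i)

∈∪⁻ : ∀ (x y : 𝒫ω) i → i ∈ω x ∪ω y → i ∈ω x ⊎ i ∈ω y
∈∪⁻ x y i i∈x∪y with x i
... | true  = inj₁ refl
... | false = inj₂ i∈x∪y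

∪-lub : x ⊆ω z → y ⊆ω z → x ∪ω y ⊆ω z
∪-lub {x} {z} {y} x⊆z y⊆z i = [ x⊆z i , y⊆z i ]′ ∘ ∈∪⁻ x y i

∪-mono : ∀ {x x′ y y′} → x ⊆ω x′ → y ⊆ω y′ → x ∪ω y ⊆ω x′ ∪ω y′
∪-mono {x′ = x′} {y′ = y′} x⊆ y⊆ = ∪-lub (⊆ω-trans x⊆ (∈∪⁺ˡ x′ y′)) (⊆ω-trans y⊆ (∈∪⁺ʳ x′ y′))

∪-interchange : ∀ a b c d → (a ∪ω b) ∪ω (c ∪ω d) ⊆ω (a ∪ω c) ∪ω (b ∪ω d)
∪-interchange a b c d = ∪-lub
  (∪-mono (∈∪⁺ˡ a c) (∈∪⁺ˡ b d))
  (∪-mono (∈∪⁺ʳ a c) (∈∪⁺ʳ b d))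

∈∩⁺ : ∀ (x y : 𝒫ω) i → i ∈ω x → i ∈ω y → i ∈ω x ∩ω y
∈∩⁺ x y i i∈x i∈y rewrite i∈x = i∈y

∩⊆ˡ : ∀ (x y : 𝒫ω) → x ∩ω y ⊆ω x
∩⊆ˡ x y i = ∧-conicalˡ (x i) (y i)

∩⊆ʳ : ∀ (x y : 𝒫ω) → x ∩ω y ⊆ω y
∩⊆ʳ x y i = ∧-conicalʳ (x i) (y i)

∩-distrib-∪ : ∀ x y z → x ∩ω (y ∪ω z) ⊆ω (x ∩ω y) ∪ω (x ∩ω z)
∩-distrib-∪ x y z i i∈ with ∈∪⁻ y z i (∩⊆ʳ x (y ∪ω z) i i∈)
... | inj₁ i∈y = ∈∪⁺ˡ (x ∩ω y) (x ∩ω z) i (∈∩⁺ x y i (∩⊆ˡ x (y ∪ω z) i i∈) i∈y)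
... | inj₂ i∈z = ∈∪⁺ʳ (x ∩ω y) (x ∩ω z) i (∈∩⁺ x z i (∩⊆ˡ x (y ∪ω z) i i∈) i∈z)

-- Agreement on initial segments.

≈-refl : x ≈[ n ] x
≈-refl _ _ = refl

≈-sym : x ≈[ n ] y → y ≈[ n ] x
≈-sym x≈y i i<n = sym (x≈y i i<n)

≈-trans : x ≈[ n ] y → y ≈[ n ] z → x ≈[ n ] z
≈-trans x≈y y≈z i i<n = trans (x≈y i i<n) (y≈z i i<n)

≈-mono : m ≤ n → x ≈[ n ] y → x ≈[ m ] y
≈-mono m≤n x≈y i i<m = x≈y i (<-≤-trans i<m m≤n)

≈-suc : x ≈[ n ] y → x n ≡ y n → x ≈[ suc n ] y
≈-suc x≈y eq i i<1+n with m<1+n⇒m<n∨m≡n i<1+n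
... | inj₁ i<n  = x≈y i i<n
... | inj₂ refl = eq

splice : ℕ → 𝒫ω → 𝒫ω → 𝒫ω
splice n x y i with <-≤-connex i n
... | inj₁ _ = x i
... | inj₂ _ = y i

splice-≈ : ∀ n x y → splice n x y ≈[ n ] x
splice-≈ n x y i i<n with <-≤-connex i n
... | inj₁ _   = refl
... | inj₂ n≤i = contradiction n≤i (<⇒≱ i<n)

splice-≥ : ∀ n x y i → n ≤ i → splice n x y i ≡ y i
splice-≥ n x y i n≤i with <-≤-connex i n
... | inj₁ i<n = contradiction n≤i (<⇒≱ i<n)
... | inj₂ _   = refl

splice-⊆ : ∀ n → x ⊆ω z → y ⊆ω z → splice n x y ⊆ω z
splice-⊆ n x⊆z y⊆z i with <-≤-connex i n
... | inj₁ _ = x⊆z i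
... | inj₂ _ = y⊆z i

below : ℕ → 𝒫ω
below n = splice n ω ∅ω

below-finite : ∀ n → Finite (below n)
below-finite n = upTo n , λ i → ∈-upTo⁺ ∘ bound i
  where
  bound : ∀ i → i ∈ω below n → i < n
  bound i i∈ with <-≤-connex i n
  bound i i∈ | inj₁ i<n = i<n
  bound i () | inj₂ _

below-mono : m ≤ n → below m ⊆ω below n
below-mono {m} {n} m≤n i i∈ with <-≤-connex i m
below-mono {m} {n} m≤n i i∈ | inj₁ i<m = splice-≈ n ω ∅ω i (<-≤-trans i<m m≤n)
below-mono {m} {n} m≤n i () | inj₂ _

-- Limits of coherent sequences

module Limit (a : ℕ → 𝒫ω) (k : ℕ → ℕ)
             (k-< : ∀ j → k j < k (suc j))
             (coherent : ∀ j → a j ≈[ k j ] a (suc j)) where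

  -- Strict growth gives `i < k (suc i)`, so stage `suc i` has already settled bit `i`.
  lim : 𝒫ω
  lim i = a (suc i) i

  private
    k-inflationary : ∀ j → j ≤ k j
    k-inflationary zero    = z≤n
    k-inflationary (suc j) = ≤-trans (s≤s (k-inflationary j)) (k-< j)

  index-< : ∀ i → i < k (suc i)
  index-< i = k-inflationary (suc i)

  k-mono : ∀ {i j} → i ≤′ j → k i ≤ k j
  k-mono ≤′-refl           = ≤-refl
  k-mono (≤′-step {j} i≤j) = ≤-trans (k-mono i≤j) (<⇒≤ (k-< j))

  private
    coherent* : ∀ {i j} → i ≤′ j → a i ≈[ k i ] a j
    coherent* ≤′-refl           = ≈-refl
    coherent* (≤′-step {j} i≤j) = ≈-trans (coherent* i≤j) (≈-mono (k-mono i≤j) (coherent j))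

  lim-≈ : ∀ j → lim ≈[ k j ] a j
  lim-≈ j i i<kj with ≤-total j (suc i)
  ... | inj₁ j≤1+i = sym (coherent* (≤⇒≤′ j≤1+i) i i<kj)
  ... | inj₂ 1+i≤j = coherent* (≤⇒≤′ 1+i≤j) i (index-< i)

-- Ideals and the sets they generate

infixl 6 _⊕_

-- The inclusion makes this downward closed for arbitrary `A` and `B`, in particular when `B` is
-- merely a closed set. For two ideals it is the family they generate together.
_⊕_ : Pred 𝒫ω ℓ → Pred 𝒫ω ℓ → Pred 𝒫ω ℓ
(A ⊕ B) x = ∃[ a ] ∃[ b ] (a ∈ A × b ∈ B × x ⊆ω a ∪ω b)

∈⊕ˡ : ∅ω ∈ B → A ⊆ A ⊕ B
∈⊕ˡ ∅∈B {x} x∈A = x , ∅ω , x∈A , ∅∈B , ∈∪⁺ˡ x ∅ω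

∈⊕ʳ : ∅ω ∈ A → B ⊆ A ⊕ B
∈⊕ʳ ∅∈A {x} x∈B = ∅ω , x , ∅∈A , x∈B , ⊆ω-refl

⊕-monoˡ : A ⊆ B → A ⊕ C ⊆ B ⊕ C
⊕-monoˡ A⊆B (a , c , a∈A , c∈C , x⊆) = a , c , A⊆B a∈A , c∈C , x⊆

∅∈ideal : IsIdeal J → ∅ω ∈ J
∅∈ideal J-ideal = IsIdeal.finite J-ideal ([] , λ _ ())

⊕-isIdeal : IsIdeal J → IsIdeal K → ω ∉ J ⊕ K → IsIdeal (J ⊕ K)
⊕-isIdeal J-ideal K-ideal ω∉ = record
  { ⊆-closed = λ { x⊆y (a , b , a∈J , b∈K , y⊆) → a , b , a∈J , b∈K , ⊆ω-trans x⊆y y⊆ }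
  ; ∪-closed = λ { (a , b , a∈J , b∈K , x⊆) (a′ , b′ , a′∈J , b′∈K , y⊆) →
      a ∪ω a′ , b ∪ω b′ , J.∪-closed a∈J a′∈J , K.∪-closed b∈K b′∈K ,
      ⊆ω-trans (∪-mono x⊆ y⊆) (∪-interchange a b a′ b′) }
  ; finite   = λ fin → ∈⊕ˡ (∅∈ideal K-ideal) (J.finite fin)
  ; proper   = ω∉
  }
  where
  module J = IsIdeal J-ideal
  module K = IsIdeal K-ideal

Initial : ∀ ℓ → ℕ → Pred 𝒫ω ℓ
Initial ℓ n x = Lift ℓ (x ⊆ω below n)

Fin : ∀ ℓ → Pred 𝒫ω ℓ
Fin ℓ = ⋃ ℕ (Initial ℓ)

Fin-isIdeal : IsIdeal (Fin ℓ)
Fin-isIdeal = record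
  { ⊆-closed = λ { x⊆y (n , lift y⊆) → n , lift (⊆ω-trans x⊆y y⊆) }
  ; ∪-closed = λ { (m , lift x⊆) (n , lift y⊆) → m ⊔ n , lift (∪-lub
      (⊆ω-trans x⊆ (below-mono (m≤m⊔n m n)))
      (⊆ω-trans y⊆ (below-mono (m≤n⊔m m n)))) }
  ; finite   = λ { (ns , x∈ns) → suc (max 0 ns) , lift λ i i∈x →
      splice-≈ (suc (max 0 ns)) ω ∅ω i (s≤s (All.lookup (xs≤max 0 ns) (x∈ns i i∈x))) }
  ; proper   = λ { (n , lift ω⊆) → contradiction
      (trans (sym (ω⊆ n refl)) (splice-≥ n ω ∅ω n ≤-refl)) (λ ()) }
  }

⋃-isIdeal : {K : ℕ → Pred 𝒫ω ℓ} → (∀ n → IsIdeal (K n)) → (∀ n → K n ⊆ K (suc n)) → IsIdeal (⋃ ℕ K)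
⋃-isIdeal {K = K} K-ideal K-mono = record
  { ⊆-closed = λ { x⊆y (n , y∈K) → n , IsIdeal.⊆-closed (K-ideal n) x⊆y y∈K }
  ; ∪-closed = λ { (m , x∈K) (n , y∈K) → m ⊔ n , IsIdeal.∪-closed (K-ideal (m ⊔ n))
      (K-mono* (≤⇒≤′ (m≤m⊔n m n)) x∈K) (K-mono* (≤⇒≤′ (m≤n⊔m m n)) y∈K) }
  ; finite   = λ fin → 0 , IsIdeal.finite (K-ideal 0) fin
  ; proper   = λ { (n , ω∈K) → IsIdeal.proper (K-ideal n) ω∈K }
  }
  where
  K-mono* : ∀ {m n} → m ≤′ n → K m ⊆ K n
  K-mono* ≤′-refl           x∈K = x∈K
  K-mono* (≤′-step {n} m≤n) x∈K = K-mono n (K-mono* m≤n x∈K)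

-- `k` counts the members of `C` used. This stratification makes the generated family a countable
-- union of Fσ sets when `A` is Fσ and `C` is closed.
adjoin[_] : ℕ → Pred 𝒫ω ℓ → Pred 𝒫ω ℓ → Pred 𝒫ω ℓ
adjoin[ zero  ] A C = A
adjoin[ suc k ] A C = adjoin[ k ] A C ⊕ C

adjoin : Pred 𝒫ω ℓ → Pred 𝒫ω ℓ → Pred 𝒫ω ℓ
adjoin A C = ⋃ ℕ λ k → adjoin[ k ] A C

adjoin-isIdeal : IsIdeal A → ω ∉ adjoin A C → IsIdeal (adjoin A C)
adjoin-isIdeal {A = A} {C = C} A-ideal ω∉ = record
  { ⊆-closed = λ { x⊆y (k , y∈) → k , down k x⊆y y∈ }
  ; ∪-closed = λ { (k , x∈) (l , y∈) → join k l x∈ y∈ }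
  ; finite   = λ fin → 0 , I.finite fin
  ; proper   = ω∉
  }
  where
  module I = IsIdeal A-ideal

  down : ∀ k → x ⊆ω y → y ∈ adjoin[ k ] A C → x ∈ adjoin[ k ] A C
  down zero    x⊆y y∈ = I.⊆-closed x⊆y y∈
  down (suc k) x⊆y (a , c , a∈ , c∈C , y⊆) = a , c , a∈ , c∈C , ⊆ω-trans x⊆y y⊆

  join₀ : ∀ k → x ∈ adjoin[ k ] A C → y ∈ A → x ∪ω y ∈ adjoin[ k ] A C
  join₀ zero x∈ y∈A = I.∪-closed x∈ y∈A
  join₀ {x = x} {y} (suc k) (a , c , a∈ , c∈C , x⊆) y∈A =
    a ∪ω y , c , join₀ k a∈ y∈A , c∈C ,
    ∪-lub (⊆ω-trans x⊆ (∪-mono (∈∪⁺ˡ a y) ⊆ω-refl))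
          (⊆ω-trans (∈∪⁺ʳ a y) (∈∪⁺ˡ (a ∪ω y) c))

  join : ∀ k l → x ∈ adjoin[ k ] A C → y ∈ adjoin[ l ] A C → x ∪ω y ∈ adjoin A C
  join k zero x∈ y∈ = k , join₀ k x∈ y∈
  join {x = x} k (suc l) x∈ (a , c , a∈ , c∈C , y⊆) with join k l x∈ a∈
  ... | j , x∪a∈ = suc j , x ∪ω a , c , x∪a∈ , c∈C ,
    ∪-lub (⊆ω-trans (∈∪⁺ˡ x a) (∈∪⁺ˡ (x ∪ω a) c))
          (⊆ω-trans y⊆ (∪-mono (∈∪⁺ʳ x a) ⊆ω-refl))

⊆adjoin : ∅ω ∈ A → C ⊆ adjoin A C
⊆adjoin ∅∈A x∈C = 1 , ∈⊕ʳ ∅∈A x∈C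

-- Associativity of sums. It turns properness of `adjoin (J ⊕ K) C` into compatibility of
-- `adjoin K C` with `J`.
⊕-adjoin : J ⊕ adjoin K C ⊆ adjoin (J ⊕ K) C
⊕-adjoin {J = J} {K = K} {C = C} (a , b , a∈J , (k , b∈) , x⊆) = k , go k a∈J b∈ x⊆
  where
  go : ∀ k {a b x} → a ∈ J → b ∈ adjoin[ k ] K C → x ⊆ω a ∪ω b → x ∈ adjoin[ k ] (J ⊕ K) C
  go zero    {a} {b} a∈J b∈K x⊆ = a , b , a∈J , b∈K , x⊆
  go (suc k) {a} a∈J (b′ , c , b′∈ , c∈C , b⊆) x⊆ =
    a ∪ω b′ , c , go k a∈J b′∈ ⊆ω-refl , c∈C ,
    ⊆ω-trans x⊆ (∪-lub (⊆ω-trans (∈∪⁺ˡ a b′) (∈∪⁺ˡ (a ∪ω b′) c))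
                       (⊆ω-trans b⊆ (∪-mono (∈∪⁺ʳ a b′) ⊆ω-refl)))

-- The sets whose trace on `X` is in `L` are closed under subsets and unions and include `L` and
-- `C`. Applied at `x = ω`: once ω is generated, an `L`-positive `X` has an `L`-positive trace on
-- some member of `C`.
adjoin-trace : ∀ X → IsIdeal L → (∀ {x} → x ∈ C → X ∩ω x ∈ L) → ∀ {x} → x ∈ adjoin L C → X ∩ω x ∈ L
adjoin-trace {L = L} {C = C} X L-ideal trace (k , x∈) = go k x∈
  where
  module I = IsIdeal L-ideal

  go : ∀ k {x} → x ∈ adjoin[ k ] L C → X ∩ω x ∈ L
  go zero    {x} x∈L = I.⊆-closed (∩⊆ʳ X x) x∈L
  go (suc k) {x} (a , c , a∈ , c∈C , x⊆) =
    I.⊆-closed (⊆ω-trans (λ i i∈ → ∈∩⁺ X (a ∪ω c) i (∩⊆ˡ X x i i∈) (x⊆ i (∩⊆ʳ X x i i∈)))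
                         (∩-distrib-∪ X a c))
               (I.∪-closed (go k a∈) (trace c∈C))

cl : Pred 𝒫ω ℓ → Pred 𝒫ω ℓ
cl A x = ∀ n → ∃[ y ] (y ∈ A × x ≈[ n ] y)

⊆cl : A ⊆ cl A
⊆cl {x = x} x∈A n = x , x∈A , ≈-refl

-- Enumerations of ℕ × ℕᵇ and of the basic open sets

-- The leading `2[1+_]` digits code the first component in unary and the next `1+[2_]` ends the
-- code; without a terminator the second component defaults to `zero`.
split : ℕᵇ → ℕ × ℕᵇ
split zero     = 0 , zero
split 2[1+ b ] = map₁ suc (split b)
split 1+[2 b ] = 0 , b

decode : ℕ → ℕ × ℕᵇ
decode c = split (fromℕ c)

decode-surjective : ∀ i b → ∃[ c ] decode c ≡ (i , b)
decode-surjective i b = toℕ (pair i) , trans (cong split (fromℕ-toℕ (pair i))) (split-pair i)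
  where
  pair : ℕ → ℕᵇ
  pair zero    = 1+[2 b ]
  pair (suc i) = 2[1+ pair i ]

  split-pair : ∀ i → split (pair i) ≡ (i , b)
  split-pair zero    = refl
  split-pair (suc i) = cong (map₁ suc) (split-pair i)

-- A bijective binary numeral is read as a finite sequence of bits.
length : ℕᵇ → ℕ
length zero     = 0
length 2[1+ b ] = suc (length b)
length 1+[2 b ] = suc (length b)

bits : ℕᵇ → 𝒫ω
bits zero     _       = false
bits 2[1+ b ] zero    = true
bits 1+[2 b ] zero    = false
bits 2[1+ b ] (suc i) = bits b i
bits 1+[2 b ] (suc i) = bits b i

Cylinder : ℕᵇ → Pred 𝒫ω _
Cylinder b x = x ≈[ length b ] bits b

prefix : ∀ x n → ∃[ b ] (length b ≡ n × x ∈ Cylinder b)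
prefix x zero = zero , refl , λ _ ()
prefix x (suc n) with prefix (x ∘ suc) n | x 0 in eq
... | b , refl , x∈ | true  = 2[1+ b ] , refl , λ { zero _ → eq ; (suc i) (s≤s i<) → x∈ i i< }
... | b , refl , x∈ | false = 1+[2 b ] , refl , λ { zero _ → eq ; (suc i) (s≤s i<) → x∈ i i< }

⋃-isFσ : {A : ℕ → Pred 𝒫ω ℓ} → (∀ n → IsFσ (A n)) → IsFσ (⋃ ℕ A)
⋃-isFσ {A = A} A-Fσ = (λ c → F (decode c)) , (λ c → closed (decode c)) , to , from
  where
  -- Reading `b` through `toℕ` lets the enumeration that lists the pieces of `J` also list pairs of
  -- naturals.
  F : ℕ × ℕᵇ → Pred 𝒫ω _
  F (i , b) = proj₁ (A-Fσ i) (toℕ b)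

  closed : ∀ p → IsClosed (F p)
  closed (i , b) = proj₁ (proj₂ (A-Fσ i)) (toℕ b)

  to : ⋃ ℕ A ⊆ ⋃ ℕ (F ∘ decode)
  to {x} (i , x∈Ai) with proj₁ (proj₂ (proj₂ (A-Fσ i))) x∈Ai
  ... | j , x∈F with decode-surjective i (fromℕ j)
  ... | c , eq = c , subst (λ p → x ∈ F p) (sym eq)
                       (subst (λ j → x ∈ proj₁ (A-Fσ i) j) (sym (toℕ-fromℕ j)) x∈F)

  from : ⋃ ℕ (F ∘ decode) ⊆ ⋃ ℕ A
  from (c , x∈F) = proj₁ (decode c) , proj₂ (proj₂ (proj₂ (A-Fσ (proj₁ (decode c))))) (_ , x∈F)

-- Compactness of `𝒫ω`, by excluded middle, and the Fσ sets it yields.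

module _ (em : ∀ {a} → ExcludedMiddle a) where

  private
    dne : ∀ {a} {P : Set a} → ¬ ¬ P → P
    dne = em⇒dne em

  counterexample : ∀ {a b} {I : Set a} {P : I → Set b} → ¬ (∀ i → P i) → ∃[ i ] ¬ P i
  counterexample ¬∀ = dne λ ¬∃ → ¬∀ λ i → dne λ ¬p → ¬∃ (i , ¬p)

  -- Bisection: at each bit, infinitely many terms stay in one half. `φ` need not increase;
  -- `n ≤ φ n` is enough to carry estimates along the subsequence.
  bolzano-weierstrass : (a : ℕ → 𝒫ω) → ∃[ x ] Σ[ φ ∈ (ℕ → ℕ) ] (∀ n → n ≤ φ n × a (φ n) ≈[ n ] x)
  bolzano-weierstrass a = lim , (λ n → proj₁ (frequent n n)) , λ n → proj₂ (frequent n n)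
    where
    Frequent : ℕ → 𝒫ω → Set
    Frequent n x = ∀ N → ∃[ m ] (N ≤ m × a m ≈[ n ] x)

    refine : ∀ n x → Frequent n x → ∃[ y ] (x ≈[ n ] y × Frequent (suc n) y)
    refine n x freq with em {P = Frequent (suc n) x}
    ... | yes freq′ = x , ≈-refl , freq′
    -- Beyond some `N` no term agrees with `x` on `suc n` bits, so those agreeing on `n` bits share
    -- the opposite bit at `n`, and any of them can replace `x`.
    ... | no ¬freq with counterexample ¬freq
    ... | N , ¬N with freq N
    ... | m , N≤m , am≈x = a m , ≈-sym am≈x , λ N′ →
      let m′ , N′≤m′ , am′≈x = freq (N ⊔ N′)
      in  m′ , ≤-trans (m≤n⊔m N N′) N′≤m′ ,
          ≈-suc (≈-trans am′≈x (≈-sym am≈x))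
                (trans (flips m′ (≤-trans (m≤m⊔n N N′) N′≤m′) am′≈x) (sym (flips m N≤m am≈x)))
      where
      flips : ∀ m → N ≤ m → a m ≈[ n ] x → a m n ≡ _
      flips m N≤m am≈x = ¬-not λ eq → ¬N (m , N≤m , ≈-suc am≈x eq)

    stage : ∀ n → ∃[ x ] Frequent n x
    stage zero    = ∅ω , λ N → N , ≤-refl , λ _ ()
    stage (suc n) = let y , _ , freq = refine n _ (proj₂ (stage n)) in y , freq

    open Limit (proj₁ ∘ stage) (λ n → n) n<1+n
               (λ n → proj₁ (proj₂ (refine n _ (proj₂ (stage n)))))

    frequent : ∀ n → Frequent n lim
    frequent n N = let m , N≤m , am≈ = proj₂ (stage n) N in m , N≤m , ≈-trans am≈ (≈-sym (lim-≈ n))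

  closed-limit : IsClosed A → (∀ n → ∃[ y ] (y ∈ A × x ≈[ n ] y)) → x ∈ A
  closed-limit closed x∈cl = dne λ x∉A →
    let n , sep     = closed _ x∉A
        y , y∈A , ≈ = x∈cl n
    in  sep y ≈ y∈A

  cl-closed : IsClosed (cl A)
  cl-closed x x∉cl with counterexample x∉cl
  ... | n , none = n , λ y x≈y y∈cl →
    let z , z∈A , y≈z = y∈cl n in none (z , z∈A , ≈-trans x≈y y≈z)

  -- Compactness: points of `A ⊕ B` approximating `z` have witnesses in `A` and `B`, which converge
  -- along a common subsequence. The inclusion passes to the limit bit by bit.
  ⊕-closed : IsClosed A → IsClosed B → IsClosed (A ⊕ B)
  ⊕-closed {A = A} {B = B} A-closed B-closed z z∉ = dne λ ¬open → z∉ (limit ¬open)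
    where
    limit : ¬ (∃[ n ] (∀ w → z ≈[ n ] w → w ∉ A ⊕ B)) → z ∈ A ⊕ B
    limit ¬open = p , q , p∈A , q∈B , z⊆
      where
      near : ∀ n → ∃[ w ] (z ≈[ n ] w × w ∈ A ⊕ B)
      near n = dne λ ¬w → ¬open (n , λ w z≈w w∈ → ¬w (w , z≈w , w∈))

      a b : ℕ → 𝒫ω
      a n = proj₁ (proj₂ (proj₂ (near n)))
      b n = proj₁ (proj₂ (proj₂ (proj₂ (near n))))

      p : 𝒫ω
      p = proj₁ (bolzano-weierstrass a)

      φ : ℕ → ℕ
      φ = proj₁ (proj₂ (bolzano-weierstrass a))

      φ-spec : ∀ n → n ≤ φ n × a (φ n) ≈[ n ] p
      φ-spec = proj₂ (proj₂ (bolzano-weierstrass a))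

      -- The second extraction runs along `φ`, so both sequences converge along `φ ∘ ψ`.
      q : 𝒫ω
      q = proj₁ (bolzano-weierstrass (b ∘ φ))

      ψ : ℕ → ℕ
      ψ = proj₁ (proj₂ (bolzano-weierstrass (b ∘ φ)))

      ψ-spec : ∀ n → n ≤ ψ n × b (φ (ψ n)) ≈[ n ] q
      ψ-spec = proj₂ (proj₂ (bolzano-weierstrass (b ∘ φ)))

      a≈p : ∀ n → p ≈[ n ] a (φ (ψ n))
      a≈p n = ≈-sym (≈-mono (proj₁ (ψ-spec n)) (proj₂ (φ-spec (ψ n))))

      b≈q : ∀ n → q ≈[ n ] b (φ (ψ n))
      b≈q n = ≈-sym (proj₂ (ψ-spec n))

      p∈A : p ∈ A
      p∈A = closed-limit A-closed λ n →
        a (φ (ψ n)) , proj₁ (proj₂ (proj₂ (proj₂ (proj₂ (near _))))) , a≈p n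

      q∈B : q ∈ B
      q∈B = closed-limit B-closed λ n →
        b (φ (ψ n)) , proj₁ (proj₂ (proj₂ (proj₂ (proj₂ (proj₂ (near _)))))) , b≈q n

      z⊆ : z ⊆ω p ∪ω q
      z⊆ i i∈z with near (φ (ψ (suc i))) | a≈p (suc i) i ≤-refl | b≈q (suc i) i ≤-refl
      ... | w , z≈w , a′ , b′ , _ , _ , w⊆ | p≡a | q≡b
        with ∈∪⁻ a′ b′ i (w⊆ i (trans (sym (z≈w i i<)) i∈z))
        where
        i< : i < φ (ψ (suc i))
        i< = ≤-trans (proj₁ (ψ-spec (suc i))) (proj₁ (φ-spec (ψ (suc i))))
      ... | inj₁ i∈a = ∈∪⁺ˡ p q i (trans p≡a i∈a)
      ... | inj₂ i∈b = ∈∪⁺ʳ p q i (trans q≡b i∈b)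

  ⊕-isFσ : IsFσ A → IsClosed C → IsFσ (A ⊕ C)
  ⊕-isFσ {C = C} (F , F-closed , A⊆F , F⊆A) C-closed =
    (λ n → F n ⊕ C) , (λ n → ⊕-closed (F-closed n) C-closed) ,
    (λ { (a , c , a∈A , c∈C , x⊆) → let n , a∈F = A⊆F a∈A in n , a , c , a∈F , c∈C , x⊆ }) ,
    (λ { (n , x∈) → ⊕-monoˡ (λ a∈F → F⊆A (n , a∈F)) x∈ })

  adjoin-isFσ : IsFσ A → IsClosed C → IsFσ (adjoin A C)
  adjoin-isFσ {A = A} {C = C} A-Fσ C-closed = ⋃-isFσ go
    where
    go : ∀ k → IsFσ (adjoin[ k ] A C)
    go zero    = A-Fσ
    go (suc k) = ⊕-isFσ (go k) C-closed

  -- Baire category and fusion.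

  -- Relative to {z | z ⊆ X, z ≈[ n ] s}, a dense Gδ subset of J would contain two points whose union
  -- covers X ∖ n.
  Gδ-not-dense : ∀ {ℓ} {J A : Pred 𝒫ω ℓ} → IsIdeal J → IsGδ A → A ⊆ J → ∀ {X} → X ∉ J → ∀ {s} → s ⊆ω X → ∀ n →
    ∃[ u ] ∃[ k ] (u ⊆ω X × s ≈[ n ] u × (∀ z → z ≈[ k ] u → z ⊆ω X → z ∉ A))
  Gδ-not-dense {ℓ} {J} {A} J-ideal (U , U-open , A⊆U , U⊆A) A⊆J {X} X∉J {s} s⊆X n =
    dne λ ¬u → contra λ u k u⊆X s≈u → dne λ ¬z →
      ¬u (u , k , u⊆X , s≈u , λ z z≈u z⊆X z∈A → ¬z (z , z∈A , z⊆X , z≈u))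
    where
    open IsIdeal J-ideal

    contra : ¬ (∀ u k → u ⊆ω X → s ≈[ n ] u → ∃[ z ] (z ∈ A × z ⊆ω X × z ≈[ k ] u))
    contra dense = X∉J (⊆-closed X⊆ (∪-closed (finite (below-finite n)) (∪-closed (A⊆J p∈A) (A⊆J q∈A))))
      where
      record Stage : Set where
        field
          k     : ℕ
          p q   : 𝒫ω
          n≤k   : n ≤ k
          p⊆X   : p ⊆ω X
          q⊆X   : q ⊆ω X
          s≈p   : s ≈[ n ] p
          s≈q   : s ≈[ n ] q
          cover : ∀ i → n ≤ i → i < k → i ∈ω X → i ∈ω p ∪ω q

      record Next (r : ℕ) (S T : Stage) : Set ℓ where
        module S = Stage S
        module T = Stage T
        field
          k<k : S.k < T.k
          p≈p : S.p ≈[ S.k ] T.p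
          q≈q : S.q ≈[ S.k ] T.q
          p∈U : ∀ z → T.p ≈[ T.k ] z → z ∈ U r
          q∈U : ∀ z → T.q ≈[ T.k ] z → z ∈ U r

      next : ∀ r S → Σ[ T ∈ Stage ] Next r S T
      next r S with dense S.p S.k S.p⊆X S.s≈p
        where module S = Stage S
      ... | z , z∈A , z⊆X , z≈p with U-open r z (A⊆U z∈A r)
      ... | l , l-nbhd = T
        where
        open Stage S

        -- `l` bits of `z` force `p` into `U r`; `suc k` keeps the lengths strictly increasing.
        k₁ : ℕ
        k₁ = suc k ⊔ l

        k≤k₁ : k ≤ k₁
        k≤k₁ = ≤-trans (n≤1+n k) (m≤m⊔n (suc k) l)

        -- `q₁` takes all of `X` from `k` on, which covers the stretch up to `k₁` where `p₂` has to
        -- copy `z`.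
        q₁ : 𝒫ω
        q₁ = splice k q X

        q₁⊆X : q₁ ⊆ω X
        q₁⊆X = splice-⊆ k q⊆X ⊆ω-refl

        s≈q₁ : s ≈[ n ] q₁
        s≈q₁ = ≈-trans s≈q (≈-mono n≤k (≈-sym (splice-≈ k q X)))

        T : Σ[ T ∈ Stage ] Next r S T
        T with dense q₁ k₁ q₁⊆X s≈q₁
        ... | w , w∈A , w⊆X , w≈q₁ with U-open r w (A⊆U w∈A r)
        ... | m , m-nbhd = record
          { k = k₂ ; p = p₂ ; q = w
          ; n≤k = ≤-trans n≤k k≤k₂
          ; p⊆X = splice-⊆ k₁ z⊆X ⊆ω-refl
          ; q⊆X = w⊆X
          ; s≈p = ≈-trans s≈p (≈-mono n≤k p≈p₂)
          ; s≈q = ≈-trans s≈q (≈-mono n≤k q≈w)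
          ; cover = cover₂
          } , record
          { k<k = ≤-trans (m≤m⊔n (suc k) l) k₁≤k₂
          ; p≈p = p≈p₂
          ; q≈q = q≈w
          ; p∈U = λ v p₂≈v → l-nbhd v (≈-trans (≈-mono (m≤n⊔m (suc k) l) z≈p₂)
                                             (≈-mono (≤-trans (m≤n⊔m (suc k) l) k₁≤k₂) p₂≈v))
          ; q∈U = λ v w≈v → m-nbhd v (≈-mono (m≤n⊔m k₁ m) w≈v)
          }
          where
          k₂ : ℕ
          k₂ = k₁ ⊔ m

          k₁≤k₂ : k₁ ≤ k₂
          k₁≤k₂ = m≤m⊔n k₁ m

          k≤k₂ : k ≤ k₂
          k≤k₂ = ≤-trans k≤k₁ k₁≤k₂

          -- Beyond `k₁` the roles swap: `p₂` takes all of `X`, while `w` is free to enter `U r`.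
          p₂ : 𝒫ω
          p₂ = splice k₁ z X

          z≈p₂ : z ≈[ k₁ ] p₂
          z≈p₂ = ≈-sym (splice-≈ k₁ z X)

          p≈p₂ : p ≈[ k ] p₂
          p≈p₂ = ≈-trans (≈-sym z≈p) (≈-mono k≤k₁ z≈p₂)

          q≈w : q ≈[ k ] w
          q≈w = ≈-trans (≈-sym (splice-≈ k q X)) (≈-mono k≤k₁ (≈-sym w≈q₁))

          cover₂ : ∀ i → n ≤ i → i < k₂ → i ∈ω X → i ∈ω p₂ ∪ω w
          cover₂ i n≤i _ i∈X =
            [ (λ i<k → [ ∈∪⁺ˡ p₂ w i ∘ trans (sym (p≈p₂ i i<k)) , ∈∪⁺ʳ p₂ w i ∘ trans (sym (q≈w i i<k)) ]′
                         (∈∪⁻ p q i (cover i n≤i i<k i∈X)))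
            , (λ k≤i → [ (λ i<k₁ → ∈∪⁺ʳ p₂ w i (trans (w≈q₁ i i<k₁) (trans (splice-≥ k q X i k≤i) i∈X)))
                       , (λ k₁≤i → ∈∪⁺ˡ p₂ w i (trans (splice-≥ k₁ z X i k₁≤i) i∈X)) ]′ (<-≤-connex i k₁))
            ]′ (<-≤-connex i k)

      stage : ℕ → Stage
      stage zero    = record
        { k = n ; p = s ; q = s ; n≤k = ≤-refl ; p⊆X = s⊆X ; q⊆X = s⊆X ; s≈p = ≈-refl ; s≈q = ≈-refl
        ; cover = λ i n≤i i<n → contradiction n≤i (<⇒≱ i<n) }
      stage (suc r) = proj₁ (next r (stage r))

      module At r = Stage (stage r)
      module Step r = Next (proj₂ (next r (stage r)))

      module P = Limit At.p At.k Step.k<k Step.p≈p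
      module Q = Limit At.q At.k Step.k<k Step.q≈q

      p∈A : P.lim ∈ A
      p∈A = U⊆A λ r → Step.p∈U r P.lim (≈-sym (P.lim-≈ (suc r)))

      q∈A : Q.lim ∈ A
      q∈A = U⊆A λ r → Step.q∈U r Q.lim (≈-sym (Q.lim-≈ (suc r)))

      X⊆ : X ⊆ω below n ∪ω (P.lim ∪ω Q.lim)
      X⊆ i i∈X =
        [ (λ i<n → ∈∪⁺ˡ (below n) (P.lim ∪ω Q.lim) i (splice-≈ n ω ∅ω i i<n))
        -- Bit `i` of each limit is by definition that of stage `suc i`, so the covering property of
        -- this stage applies verbatim.
        , (λ n≤i → ∈∪⁺ʳ (below n) (P.lim ∪ω Q.lim) i (At.cover (suc i) i n≤i (P.index-< i) i∈X))
        ]′ (<-≤-connex i n)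

  -- Fusion by contradiction: stage `r` traps `p` in `O r` and drives `u` out of `H r`. Positivity
  -- is measured by `L`, since this is what passes to traces; it implies the `J`-positivity that
  -- `Gδ-not-dense` asks for.
  extendable-neighbourhood : ∀ {ℓ} {J L A D : Pred 𝒫ω ℓ} →
    IsIdeal J → IsGδσ J → IsIdeal L → J ⊆ L → IsGδ A → A ⊆ J → D ⊆ A → ∀ {y} → y ∈ D →
    ∃[ z ] ∃[ m ] (z ∈ D × ω ∉ adjoin L (cl (λ w → w ∈ D × z ≈[ m ] w)))
  extendable-neighbourhood {ℓ} {J} {L} {A} {D} J-ideal (H , H-Gδ , J⊆H , H⊆J) L-ideal J⊆L
    (O , O-open , A⊆O , O⊆A) A⊆J D⊆A {y₀} y₀∈D =
    dne λ ¬∃ → contra λ z m z∈D → dne λ ω∉ → ¬∃ (z , m , z∈D , ω∉)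
    where
    module L = IsIdeal L-ideal

    N : 𝒫ω → ℕ → Pred 𝒫ω ℓ
    N z m = cl (λ w → w ∈ D × z ≈[ m ] w)

    contra : ¬ (∀ z m → z ∈ D → ω ∈ adjoin L (N z m))
    contra improper = escape (J⊆H (IsIdeal.⊆-closed J-ideal u⊆p (A⊆J (O⊆A p∈O))))
      where
      positive-trace : ∀ {X} → X ∉ L → ∀ {z} m → z ∈ D → ∃[ x ] (x ∈ N z m × X ∩ω x ∉ L)
      positive-trace {X} X∉L {z} m z∈D = dne λ ¬∃ → X∉L
        (L.⊆-closed (λ i i∈X → ∈∩⁺ X ω i i∈X refl)
          (adjoin-trace X L-ideal (λ {x} x∈N → dne λ ∉L → ¬∃ (x , x∈N , ∉L)) (improper z m z∈D)))

      record Stage : Set ℓ where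
        field
          k    : ℕ
          p    : 𝒫ω
          X    : 𝒫ω
          u    : 𝒫ω
          p∈D  : p ∈ D
          X∉L  : X ∉ L
          u⊆X  : u ⊆ω X
          u⊆p  : ∀ i → i < k → i ∈ω u → i ∈ω p

      record Next (r : ℕ) (S T : Stage) : Set ℓ where
        module S = Stage S
        module T = Stage T
        field
          k<k : S.k < T.k
          p≈p : S.p ≈[ S.k ] T.p
          u≈u : S.u ≈[ S.k ] T.u
          X⊆X : T.X ⊆ω S.X
          p∈O : ∀ z → T.p ≈[ T.k ] z → z ∈ O r
          u∉H : ∀ z → z ≈[ T.k ] T.u → z ⊆ω T.X → z ∉ H r

      next : ∀ r S → Σ[ T ∈ Stage ] Next r S T
      next r S = T , S→T
        where
        open Stage S

        nbhd : ∃[ l ] (∀ z → p ≈[ l ] z → z ∈ O r)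
        nbhd = O-open r p (A⊆O (D⊆A p∈D) r)

        l : ℕ
        l = suc k ⊔ proj₁ nbhd

        k<l : k < l
        k<l = m≤m⊔n (suc k) (proj₁ nbhd)

        trace : ∃[ v ] (v ∈ N p l × X ∩ω v ∉ L)
        trace = positive-trace X∉L l p∈D

        v : 𝒫ω
        v = proj₁ trace

        near : ∀ h → ∃[ w ] ((w ∈ D × p ≈[ l ] w) × v ≈[ h ] w)
        near = proj₁ (proj₂ trace)

        X′ : 𝒫ω
        X′ = X ∩ω v

        X′∉L : X′ ∉ L
        X′∉L = proj₂ (proj₂ trace)

        u∩v⊆X′ : u ∩ω v ⊆ω X′
        u∩v⊆X′ i i∈ = ∈∩⁺ X v i (u⊆X i (∩⊆ˡ u v i i∈)) (∩⊆ʳ u v i i∈)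

        -- Below `k` the limit point `v` agrees with `p`, and `u` lies under `p`, so intersecting
        -- with `v` leaves the settled bits of `u` unchanged.
        u≈u∩v : u ≈[ k ] (u ∩ω v)
        u≈u∩v i i<k with u i | u⊆p i i<k
        ... | false | _   = refl
        ... | true  | i∈p =
          let _ , (_ , p≈w) , v≈w = near l
          in  sym (trans (≈-mono (<⇒≤ k<l) (≈-trans v≈w (≈-sym p≈w)) i i<k) (i∈p refl))

        avoid : ∃[ u′ ] ∃[ h ] (u′ ⊆ω X′ × (u ∩ω v) ≈[ k ] u′ × (∀ z → z ≈[ h ] u′ → z ⊆ω X′ → z ∉ H r))
        avoid = Gδ-not-dense J-ideal (H-Gδ r) (λ z∈H → H⊆J (r , z∈H)) (X′∉L ∘ J⊆L) u∩v⊆X′ k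

        u′ : 𝒫ω
        u′ = proj₁ avoid

        h : ℕ
        h = l ⊔ proj₁ (proj₂ avoid)

        u′⊆X′ : u′ ⊆ω X′
        u′⊆X′ = proj₁ (proj₂ (proj₂ avoid))

        l≤h : l ≤ h
        l≤h = m≤m⊔n l (proj₁ (proj₂ avoid))

        -- `u′` lies under `v`, so a point of `D` agreeing with `v` below `h` restores the invariant
        -- `u⊆p`.
        p′ : 𝒫ω
        p′ = proj₁ (near h)

        p≈p′ : p ≈[ l ] p′
        p≈p′ = proj₂ (proj₁ (proj₂ (near h)))

        T : Stage
        T = record
          { k = h ; p = p′ ; X = X′ ; u = u′
          ; p∈D = proj₁ (proj₁ (proj₂ (near h)))
          ; X∉L = X′∉L
          ; u⊆X = u′⊆X′
          ; u⊆p = λ i i<h i∈u′ → trans (sym (proj₂ (proj₂ (near h)) i i<h)) (∩⊆ʳ X v i (u′⊆X′ i i∈u′))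
          }

        S→T : Next r S T
        S→T = record
          { k<k = ≤-trans k<l l≤h
          ; p≈p = ≈-mono (<⇒≤ k<l) p≈p′
          ; u≈u = ≈-trans u≈u∩v (proj₁ (proj₂ (proj₂ (proj₂ avoid))))
          ; X⊆X = ∩⊆ˡ X v
          ; p∈O = λ z p′≈z → proj₂ nbhd z (≈-mono (m≤n⊔m (suc k) (proj₁ nbhd)) (≈-trans p≈p′ (≈-mono l≤h p′≈z)))
          ; u∉H = λ z z≈u′ → proj₂ (proj₂ (proj₂ (proj₂ avoid))) z (≈-mono (m≤n⊔m l (proj₁ (proj₂ avoid))) z≈u′)
          }

      stage : ℕ → Stage
      stage zero    = record
        { k = 0 ; p = y₀ ; X = ω ; u = ∅ω ; p∈D = y₀∈D ; X∉L = L.proper ; u⊆X = λ _ () ; u⊆p = λ _ () }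
      stage (suc r) = proj₁ (next r (stage r))

      module At r = Stage (stage r)
      module Step r = Next (proj₂ (next r (stage r)))

      module P = Limit At.p At.k Step.k<k Step.p≈p
      module U = Limit At.u At.k Step.k<k Step.u≈u

      p∈O : ∀ r → P.lim ∈ O r
      p∈O r = Step.p∈O r P.lim (≈-sym (P.lim-≈ (suc r)))

      u⊆p : U.lim ⊆ω P.lim
      u⊆p i i∈u = trans (P.lim-≈ (suc i) i (U.index-< i)) (At.u⊆p (suc i) i (U.index-< i) i∈u)

      X-antitone : ∀ {r t} → r ≤′ t → At.X t ⊆ω At.X r
      X-antitone ≤′-refl           = ⊆ω-refl
      X-antitone (≤′-step {t} r≤t) = ⊆ω-trans (Step.X⊆X t) (X-antitone r≤t)

      u⊆X : ∀ r → U.lim ⊆ω At.X r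
      -- Bit `i` is settled at stage `suc i`, while lying under `At.X r` takes a stage from `r` on;
      -- the maximum serves both.
      u⊆X r i i∈u = X-antitone (≤⇒≤′ (m≤m⊔n r (suc i))) i
        (At.u⊆X (r ⊔ suc i) i
          (trans (sym (U.lim-≈ (r ⊔ suc i) i (<-≤-trans (U.index-< i) (U.k-mono (≤⇒≤′ (m≤n⊔m r (suc i))))))) i∈u))

      escape : U.lim ∉ ⋃ ℕ H
      escape (r , u∈H) = Step.u∉H r U.lim (U.lim-≈ (suc r)) (u⊆X (suc r)) u∈H

  -- Compatible Fσ ideals and the saturated chain.

  Fin-isFσ : IsFσ (Fin ℓ)
  Fin-isFσ {ℓ} = Initial ℓ , closed , (λ x∈ → x∈) , (λ x∈ → x∈)
    where
    closed : ∀ n → IsClosed (Initial ℓ n)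
    closed n x x∉ with counterexample (λ x⊆ → x∉ (lift λ i → x⊆ i))
    ... | i , ¬imp = suc i , λ y x≈y (lift y⊆) → ¬imp λ i∈x → y⊆ i (trans (sym (x≈y i (n<1+n i))) i∈x)

  module Extension {ℓ} {J : Pred 𝒫ω ℓ} (J-ideal : IsIdeal J) (J-Gδσ : IsGδσ J) where

    module J = IsIdeal J-ideal

    G : ℕ → Pred 𝒫ω ℓ
    G = proj₁ J-Gδσ

    G⊆J : ∀ n → G n ⊆ J
    G⊆J n x∈G = proj₂ (proj₂ (proj₂ J-Gδσ)) (n , x∈G)

    record Compatible (K : Pred 𝒫ω ℓ) : Set (Level.suc ℓ) where
      field
        isIdeal : IsIdeal K
        isFσ    : IsFσ K
        proper  : ω ∉ J ⊕ K

    Piece : ℕ × ℕᵇ → Pred 𝒫ω ℓ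
    Piece (n , b) = G n ∩ Cylinder b

    -- `J` absorbs finite sets, so compatibility reduces to its own properness.
    Fin-compatible : Compatible (Fin ℓ)
    Fin-compatible = record
      { isIdeal = Fin-isIdeal
      ; isFσ    = Fin-isFσ
      ; proper  = λ { (a , b , a∈J , (n , lift b⊆) , ω⊆) → J.proper
          (J.⊆-closed (⊆ω-trans ω⊆ (∪-mono ⊆ω-refl b⊆)) (J.∪-closed a∈J (J.finite (below-finite n)))) }
      }

    Extends : ℕ × ℕᵇ → Pred 𝒫ω ℓ → Set (Level.suc ℓ)
    Extends p K = Σ[ K′ ∈ Pred 𝒫ω ℓ ] (Compatible K′ × K ⊆ K′ × Piece p ⊆ K′)

    -- A point of `J` outside `K` lies in some `D n`. `extendable-neighbourhood` then yields a
    -- cylinder about a point of `D n` whose piece some compatible ideal above `K` contains;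
    -- saturation puts that piece inside `K`, against the choice of `D n`.
    saturated⇒⊇ : ∀ {K} → Compatible K → (∀ p → Extends p K → Piece p ⊆ K) → J ⊆ K
    saturated⇒⊇ {K} K-comp saturated {x} x∈J = dne λ x∉K →
      let n , x∈G = proj₁ (proj₂ (proj₂ J-Gδσ)) x∈J
      in  contra n (x∈G , λ b x∈b covered → x∉K (covered (x∈G , x∈b)))
      where
      open Compatible K-comp

      D : ℕ → Pred 𝒫ω ℓ
      D n y = y ∈ G n × (∀ b → y ∈ Cylinder b → ¬ (Piece (n , b) ⊆ K))

      N : ℕ → 𝒫ω → ℕ → Pred 𝒫ω ℓ
      N n y m = cl (λ w → w ∈ D n × y ≈[ m ] w)

      extends : ∀ n {y} b → y ∈ Cylinder b → ω ∉ adjoin (J ⊕ K) (N n y (length b)) → Extends (n , b) K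
      extends n {y} b y∈b ω∉ = K⁺ , compatible , (0 ,_) , covers
        where
        -- The closure is adjoined to `K` alone, because `J ⊕ K` may fail to be Fσ.
        K⁺ : Pred 𝒫ω ℓ
        K⁺ = adjoin K (N n y (length b))

        K⁺-proper : ω ∉ J ⊕ K⁺
        K⁺-proper ω∈ = ω∉ (⊕-adjoin {J = J} {K = K} {C = N n y (length b)} ω∈)

        compatible : Compatible K⁺
        compatible = record
          { isIdeal = adjoin-isIdeal isIdeal λ ω∈ → K⁺-proper (∈⊕ʳ {A = J} {B = K⁺} (∅∈ideal J-ideal) ω∈)
          ; isFσ    = adjoin-isFσ isFσ cl-closed
          ; proper  = K⁺-proper
          }

        covers : Piece (n , b) ⊆ K⁺
        covers {z} (z∈G , z∈b) with em {P = z ∈ K}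
        ... | yes z∈K = 0 , z∈K
        -- A point outside `K` is in `D n`: any piece within `K` on a cylinder around it would
        -- contain it.
        ... | no  z∉K = ⊆adjoin (∅∈ideal isIdeal)
          (⊆cl ((z∈G , λ b′ z∈b′ covered → z∉K (covered (z∈G , z∈b′))) , ≈-trans y∈b (≈-sym z∈b)))

      contra : ∀ n → x ∉ D n
      contra n x∈D = use (extendable-neighbourhood {J = J} {L = J ⊕ K} {A = G n} {D = D n} J-ideal J-Gδσ
          (⊕-isIdeal J-ideal isIdeal proper)
          (∈⊕ˡ {B = K} {A = J} (∅∈ideal isIdeal)) (proj₁ (proj₂ J-Gδσ) n) (G⊆J n) proj₁ x∈D)
        where
        use : ¬ (∃[ y ] ∃[ m ] (y ∈ D n × ω ∉ adjoin (J ⊕ K) (N n y m)))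
        use (y , m , (_ , y∉) , ω∉) =
          let b , b≡m , y∈b = prefix y m
          in  y∉ b y∈b (saturated (n , b)
                (extends n b y∈b (subst (λ m → ω ∉ adjoin (J ⊕ K) (N n y m)) (sym b≡m) ω∉)))

    extend : ∀ p {K} → Compatible K →
      Σ[ K′ ∈ Pred 𝒫ω ℓ ] (Compatible K′ × K ⊆ K′ × (Extends p K → Piece p ⊆ K′))
    extend p {K} K-comp with em {P = Extends p K}
    ... | yes (K′ , K′-comp , K⊆K′ , covers) = K′ , K′-comp , K⊆K′ , λ _ → covers
    ... | no ¬ext                           = K , K-comp , (λ x∈K → x∈K) , λ ext → contradiction ext ¬ext

    chain : ℕ → Σ[ K ∈ Pred 𝒫ω ℓ ] Compatible K
    chain zero    = Fin ℓ , Fin-compatible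
    chain (suc c) = let K , K-comp , _ = extend (decode c) (proj₂ (chain c)) in K , K-comp

    stage : ℕ → Pred 𝒫ω ℓ
    stage c = proj₁ (chain c)

    module Stage c = Compatible (proj₂ (chain c))

    J′ : Pred 𝒫ω ℓ
    J′ = ⋃ ℕ stage

    J′-compatible : Compatible J′
    J′-compatible = record
      { isIdeal = ⋃-isIdeal Stage.isIdeal λ c →
          proj₁ (proj₂ (proj₂ (extend (decode c) (proj₂ (chain c)))))
      ; isFσ    = ⋃-isFσ Stage.isFσ
      ; proper  = λ { (a , b , a∈J , (c , b∈) , ω⊆) → Stage.proper c (a , b , a∈J , b∈ , ω⊆) }
      }

    module J′ = Compatible J′-compatible

    -- One visit per piece suffices: a compatible extension of `J′` also extends stage `c`, so stage
    -- `suc c` already took in the piece.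
    saturated : ∀ p → Extends p J′ → Piece p ⊆ J′
    saturated (n , b) (K , K-comp , J′⊆K , covers) {x} x∈ with decode-surjective n b
    ... | c , refl = suc c ,
      proj₂ (proj₂ (proj₂ (extend (decode c) (proj₂ (chain c)))))
        (K , K-comp , (λ x∈stage → J′⊆K (c , x∈stage)) , covers) x∈

    J⊆J′ : J ⊆ J′
    J⊆J′ = saturated⇒⊇ J′-compatible saturated

proposition10p1 : (∀ {a} → ExcludedMiddle a) →
    ∀ {ℓ} (J : Pred 𝒫ω ℓ) → IsIdeal J → IsGδσ J →
    Σ[ J′ ∈ Pred 𝒫ω ℓ ] (IsIdeal J′ × IsFσ J′ × J ⊆ J′)
proposition10p1 em J J-ideal J-Gδσ = J′ , J′.isIdeal , J′.isFσ , J⊆J′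
  where open Extension em J-ideal J-Gδσ
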